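{- For every connected finite simple graph $G$ with at least $2$ vertices and every minimum connecting transition set $T$ of $G$, we have $|T|\ge \frac{2}{3}\tau(G)$, where \[\tau(G)=\sum_{C} \begin{cases}|C|-2 & \text{if } G[C] \text{ is connected},\\ |C|-1 & \text{otherwise},\end{cases}\] the sum ranging over all co-connected components $C$ of $G$ with $|C|\ge 2$. (Consequently, outputting a connecting transition set of size $\tau(G)$ gives a $\frac32$-approximation.)
   Context: The co-connected components of $G$ are the vertex sets of the connected components of the complement $\bar G$. A transition is a set of two distinct adjacent edges $\{ab,bc\}$ with $a\neq c$, written $abc$. Given a set $T$ of transitions, a walk $(v_1,\dots,v_k)$ is $T$-compatible if for every $i\in[1,k-2]$, either $v_iv_{i+1}v_{i+2}\in T$ or $v_i=v_{i+2}$. $T$ is a connecting transition set of $G$ if for all vertices $u,v$ there is a $T$-compatible walk from $u$ to $v$; it is minimum if of minimum cardinality. -}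

module Defs where

open import Data.Nat using (ℕ; zero; suc; _+_; _∸_; _≤_; _<_)
open import Data.Bool using (Bool; true; false; _∧_; _∨_; not; if_then_else_)
open import Data.Fin using (Fin; toℕ) renaming (zero to fzero; suc to fsuc)
open import Data.Fin.Properties using (_≟_)
open import Data.List using (List; []; _∷_)
open import Data.Product using (Σ; _×_; _,_)
open import Data.Sum using (_⊎_)
open import Data.Unit using (⊤)
open import Relation.Nullary using (¬_)
open import Relation.Nullary.Decidable using (⌊_⌋)
open import Relation.Binary.PropositionalEquality using (_≡_)

record Graph (n : ℕ) : Set where
  field
    adj     : Fin n → Fin n → Bool
    adj-sym : ∀ u v → adj u v ≡ adj v u
    irrefl  : ∀ v → adj v v ≡ false
open Graph public

lastFrom : ∀ {n} → Fin n → List (Fin n) → Fin n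
lastFrom u []       = u
lastFrom u (x ∷ xs) = lastFrom x xs

IsWalk : ∀ {n} → Graph n → Fin n → List (Fin n) → Set
IsWalk G u []       = ⊤
IsWalk G u (x ∷ xs) = (adj G u x ≡ true) × IsWalk G x xs

Connected : ∀ {n} → Graph n → Set
Connected {n} G = ∀ (u v : Fin n) →
  Σ (List (Fin n)) λ xs → IsWalk G u xs × lastFrom u xs ≡ v

IsTransition : ∀ {n} → Graph n → Fin n → Fin n → Fin n → Set
IsTransition G a b c = (adj G a b ≡ true) × (adj G b c ≡ true) × ¬ (a ≡ c)

-- A set T of transitions, given by its (decidable) membership predicate
-- on ordered triples; abc and cba denote the same transition {ab,bc}.
record TransitionSet {n} (G : Graph n) : Set where
  field
    mem      : Fin n → Fin n → Fin n → Bool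
    mem-sym  : ∀ a b c → mem a b c ≡ mem c b a
    mem-valid : ∀ a b c → mem a b c ≡ true → IsTransition G a b c
open TransitionSet public

Compatible : ∀ {n} {G : Graph n} → TransitionSet G → Fin n → List (Fin n) → Set
Compatible T a []                = ⊤
Compatible T a (b ∷ [])          = ⊤
Compatible T a (b ∷ c ∷ rest)    =
  ((mem T a b c ≡ true) ⊎ (a ≡ c)) × Compatible T b (c ∷ rest)

IsConnectingTransitionSet : ∀ {n} {G : Graph n} → TransitionSet G → Set
IsConnectingTransitionSet {n} {G} T = ∀ (u v : Fin n) →
  Σ (List (Fin n)) λ xs → IsWalk G u xs × Compatible T u xs × lastFrom u xs ≡ v

count : ∀ {n} → (Fin n → Bool) → ℕ
count {zero}  f = 0
count {suc n} f = (if f fzero then 1 else 0) + count (λ i → f (fsuc i))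

sumF : ∀ {n} → (Fin n → ℕ) → ℕ
sumF {zero}  f = 0
sumF {suc n} f = f fzero + sumF (λ i → f (fsuc i))

-- |T| : each transition {ab,bc} (a ≠ c) is counted once, via the
-- representative triple with toℕ a < toℕ c.
card : ∀ {n} {G : Graph n} → TransitionSet G → ℕ
card T = sumF λ a → sumF λ b → count λ c →
  mem T a b c ∧ ⌊ toℕ a Data.Nat.<? toℕ c ⌋

IsMinimumConnectingTransitionSet : ∀ {n} {G : Graph n} → TransitionSet G → Set
IsMinimumConnectingTransitionSet {n} {G} T =
  IsConnectingTransitionSet T ×
  (∀ (T' : TransitionSet G) → IsConnectingTransitionSet T' → card T ≤ card T')

anyF : ∀ {n} → (Fin n → Bool) → Bool
anyF {zero}  f = false
anyF {suc n} f = f fzero ∨ anyF (λ i → f (fsuc i))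

allF : ∀ {n} → (Fin n → Bool) → Bool
allF {zero}  f = true
allF {suc n} f = f fzero ∧ allF (λ i → f (fsuc i))

reachWithin : ∀ {n} → (Fin n → Fin n → Bool) → (Fin n → Bool) →
              ℕ → Fin n → Fin n → Bool
reachWithin R S zero    u v = S u ∧ ⌊ u ≟ v ⌋
reachWithin R S (suc k) u v =
  reachWithin R S k u v ∨ anyF (λ w → reachWithin R S k u w ∧ R w v ∧ S v)

-- u, v connected by a walk inside S (walks of length < n suffice)
reachIn : ∀ {n} → (Fin n → Fin n → Bool) → (Fin n → Bool) → Fin n → Fin n → Bool
reachIn {n} R S = reachWithin R S n

coAdj : ∀ {n} → Graph n → Fin n → Fin n → Bool
coAdj G u v = not (adj G u v) ∧ not ⌊ u ≟ v ⌋

coComp : ∀ {n} → Graph n → Fin n → Fin n → Bool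
coComp G v = reachIn (coAdj G) (λ _ → true) v

inducedConnected : ∀ {n} → Graph n → (Fin n → Bool) → Bool
inducedConnected G C = allF λ u → allF λ v →
  not (C u ∧ C v) ∨ reachIn (adj G) C u v

isRep : ∀ {n} → Graph n → Fin n → Bool
isRep G v = not (anyF λ u → coComp G v u ∧ ⌊ toℕ u Data.Nat.<? toℕ v ⌋)

contrib : ∀ {n} → Graph n → (Fin n → Bool) → ℕ
contrib G C with count C
... | zero        = 0
... | suc zero    = 0
... | s@(suc (suc _)) = if inducedConnected G C then s ∸ 2 else s ∸ 1

-- τ(G): sum over co-connected components (each taken once via its representative)
τ : ∀ {n} → Graph n → ℕ
τ G = sumF λ v → if isRep G v then contrib G (coComp G v) else 0

{-# OPTIONS --safe #-}

-- Two edges of G are equivalent when a T-compatible walk can pass from one to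
-- the other.  A class of edges held together by t transitions spans at most
-- t + 2 vertices, and T is connecting iff any two vertices are spanned by a
-- common class.  All non-adjacent pairs inside one class can be joined using at
-- most 3t/2 links: none if t = 0 (an edge), the link ac if t = 1 (a path abc),
-- and a spanning star, with at most t + 1 links, if t ≥ 2.  So at most 3|T|/2
-- links connect every co-connected component, which takes at least
-- Σ (|C| - 1) ≥ τ(G) of them.
module Submission where

open import Defs
open import Data.Nat using (ℕ; zero; suc; _+_; _*_; _≤_; _<_; z≤n; s≤s; s≤s⁻¹; _<?_; _≤?_)
open import Data.Nat.Properties hiding (_≟_; _<?_; _≤?_)
open import Data.Nat.Induction using (<-wellFounded)
open import Data.Nat.Tactic.RingSolver using (solve-∀)
open import Induction.WellFounded using (Acc; acc)
open import Data.Bool using (Bool; true; false; _∧_; _∨_; not; if_then_else_)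
open import Data.Bool.Properties using (∧-conicalˡ; ∧-conicalʳ; ∨-zeroʳ; not-injective)
open import Data.Fin using (Fin; toℕ; combine; remQuot) renaming (zero to fzero; suc to fsuc)
open import Data.Fin.Properties using (_≟_; toℕ-injective; remQuot-combine; injective⇒≤)
open import Data.List using (List; []; _∷_; _++_; length; map; lookup)
open import Data.List.Properties using (length-++; length-map)
open import Data.List.Membership.Propositional using (_∈_)
open import Data.List.Membership.Propositional.Properties using (∈-++⁺ˡ; ∈-++⁺ʳ; ∈-++⁻; ∈-map⁺)
open import Data.List.Relation.Unary.Any using (here; there; index)
open import Data.List.Relation.Unary.Any.Properties using (lookup-index)
open import Data.Product using (∃-syntax; _×_; _,_; proj₁; proj₂)
open import Data.Sum using (_⊎_; inj₁; inj₂)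
open import Data.Vec.Functional using (updateAt)
open import Data.Vec.Functional.Properties using (updateAt-updates; updateAt-minimal)
open import Function using (_∘_; const; case_of_)
open import Relation.Nullary using (¬_; Dec; yes; no; contradiction)
open import Relation.Nullary.Decidable using (⌊_⌋)
open import Relation.Binary.Definitions using (tri<; tri≈; tri>)
open import Relation.Binary.PropositionalEquality

private variable
  n : ℕ
  A : Set

-- Booleans and decisions

∨-true⁻ : ∀ {x y} → x ∨ y ≡ true → x ≡ true ⊎ y ≡ true
∨-true⁻ {true}  _ = inj₁ refl
∨-true⁻ {false} e = inj₂ e

⌊⌋-true⁻ : (d : Dec A) → ⌊ d ⌋ ≡ true → A
⌊⌋-true⁻ (yes a) _ = a

⌊⌋-true⁺ : (d : Dec A) → A → ⌊ d ⌋ ≡ true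
⌊⌋-true⁺ (yes _) _ = refl
⌊⌋-true⁺ (no ¬a) a = contradiction a ¬a

⌊⌋-false⁺ : (d : Dec A) → ¬ A → ⌊ d ⌋ ≡ false
⌊⌋-false⁺ (yes a) ¬a = contradiction a ¬a
⌊⌋-false⁺ (no _)  _  = refl

-- Finite sums and counting

anyF⁺ : (f : Fin n → Bool) (i : Fin n) → f i ≡ true → anyF f ≡ true
anyF⁺ f fzero    e rewrite e = refl
anyF⁺ f (fsuc i) e rewrite anyF⁺ (f ∘ fsuc) i e = ∨-zeroʳ (f fzero)

anyF⁻ : (f : Fin n → Bool) → anyF f ≡ true → ∃[ i ] f i ≡ true
anyF⁻ {suc n} f e with ∨-true⁻ {f fzero} e
... | inj₁ e₀ = fzero , e₀
... | inj₂ e₁ with anyF⁻ (f ∘ fsuc) e₁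
...   | i , p = fsuc i , p

sumF-cong : {f g : Fin n → ℕ} → (∀ i → f i ≡ g i) → sumF f ≡ sumF g
sumF-cong {zero}  h = refl
sumF-cong {suc n} h = cong₂ _+_ (h fzero) (sumF-cong (h ∘ fsuc))

sumF-mono-≤ : {f g : Fin n → ℕ} → (∀ i → f i ≤ g i) → sumF f ≤ sumF g
sumF-mono-≤ {zero}  h = z≤n
sumF-mono-≤ {suc n} h = +-mono-≤ (h fzero) (sumF-mono-≤ (h ∘ fsuc))

sumF-+ : (f g : Fin n → ℕ) → sumF (λ i → f i + g i) ≡ sumF f + sumF g
sumF-+ {zero}  f g = refl
sumF-+ {suc n} f g rewrite sumF-+ (f ∘ fsuc) (g ∘ fsuc) =
  interchange (f fzero) (g fzero) (sumF (f ∘ fsuc)) (sumF (g ∘ fsuc))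
  where
  interchange : ∀ a b c d → (a + b) + (c + d) ≡ (a + c) + (b + d)
  interchange = solve-∀

sumF-* : (k : ℕ) (f : Fin n → ℕ) → sumF (λ i → k * f i) ≡ k * sumF f
sumF-* {zero}  k f = sym (*-zeroʳ k)
sumF-* {suc n} k f rewrite sumF-* k (f ∘ fsuc) = sym (*-distribˡ-+ k (f fzero) _)

sumF-const : (k : ℕ) → sumF {n} (λ _ → k) ≡ n * k
sumF-const {zero}  k = refl
sumF-const {suc n} k = cong (k +_) (sumF-const {n} k)

sumF-swap : ∀ {m} (f : Fin m → Fin n → ℕ) →
            sumF (λ i → sumF (f i)) ≡ sumF (λ j → sumF (λ i → f i j))
sumF-swap {n} {zero}  f = sym (trans (sumF-const {n} 0) (*-zeroʳ n))
sumF-swap {n} {suc m} f rewrite sumF-swap (f ∘ fsuc) = sym (sumF-+ (f fzero) _)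

indicator : Bool → ℕ
indicator b = if b then 1 else 0

count-sumF : (f : Fin n → Bool) → count f ≡ sumF (indicator ∘ f)
count-sumF {zero}  f = refl
count-sumF {suc n} f = cong (indicator (f fzero) +_) (count-sumF (f ∘ fsuc))

count≤n : (f : Fin n → Bool) → count f ≤ n
count≤n {zero}  f = z≤n
count≤n {suc n} f with f fzero
... | true  = s≤s (count≤n (f ∘ fsuc))
... | false = m≤n⇒m≤1+n (count≤n (f ∘ fsuc))

count-≥1 : (f : Fin n → Bool) (i : Fin n) → f i ≡ true → 1 ≤ count f
count-≥1 f fzero    e rewrite e = s≤s z≤n
count-≥1 f (fsuc i) e = m≤n⇒m≤o+n _ (count-≥1 (f ∘ fsuc) i e)

count-none : (f : Fin n → Bool) → (∀ i → f i ≡ false) → count f ≡ 0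
count-none {zero}  f h = refl
count-none {suc n} f h rewrite h fzero = count-none (f ∘ fsuc) (h ∘ fsuc)

count-≤1 : (f : Fin n → Bool) →
           (∀ i j → f i ≡ true → f j ≡ true → i ≡ j) → count f ≤ 1
count-≤1 {zero}  f h = z≤n
count-≤1 {suc n} f h with f fzero in e₀
... | false = count-≤1 (f ∘ fsuc) λ i j p q → case h (fsuc i) (fsuc j) p q of λ where refl → refl
... | true  = s≤s (≤-reflexive (count-none (f ∘ fsuc) others))
  where
  others : ∀ i → f (fsuc i) ≡ false
  others i with f (fsuc i) in e
  ... | false = refl
  ... | true  = case h fzero (fsuc i) e₀ e of λ ()

-- The dichotomy drives the stabilisation of `reach`: a stage either adds nothing or strictly gains.
-- The equality of counts in the first case is what the induction needs when `g` gains its new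
-- element at the head.
count-⊆ : (f g : Fin n → Bool) → (∀ i → f i ≡ true → g i ≡ true) →
          (∀ i → g i ≡ true → f i ≡ true) × count f ≡ count g ⊎ count f < count g
count-⊆ {zero}  f g h = inj₁ ((λ ()) , refl)
count-⊆ {suc n} f g h
  with f fzero in ef | g fzero in eg | count-⊆ (f ∘ fsuc) (g ∘ fsuc) (h ∘ fsuc)
... | true  | true  | inj₁ (r , e) = inj₁ ((λ { fzero _ → ef ; (fsuc i) → r i }) , cong suc e)
... | true  | true  | inj₂ l       = inj₂ (s≤s l)
... | true  | false | _            = case trans (sym eg) (h fzero ef) of λ ()
... | false | true  | inj₁ (r , e) = inj₂ (s≤s (≤-reflexive e))
... | false | true  | inj₂ l       = inj₂ (m≤n⇒m≤1+n l)
... | false | false | inj₁ (r , e) =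
  inj₁ ((λ { fzero p → case trans (sym eg) p of λ () ; (fsuc i) → r i }) , e)
... | false | false | inj₂ l       = inj₂ l

concatF : (Fin n → List A) → List A
concatF {zero}  f = []
concatF {suc n} f = f fzero ++ concatF (f ∘ fsuc)

length-concatF : (f : Fin n → List A) → length (concatF f) ≡ sumF (length ∘ f)
length-concatF {zero}  f = refl
length-concatF {suc n} f =
  trans (length-++ (f fzero)) (cong (length (f fzero) +_) (length-concatF (f ∘ fsuc)))

∈-concatF⁺ : (f : Fin n → List A) (i : Fin n) {x : A} → x ∈ f i → x ∈ concatF f
∈-concatF⁺ f fzero    p = ∈-++⁺ˡ p
∈-concatF⁺ f (fsuc i) p = ∈-++⁺ʳ (f fzero) (∈-concatF⁺ (f ∘ fsuc) i p)

∈-concatF⁻ : (f : Fin n → List A) {x : A} → x ∈ concatF f → ∃[ i ] x ∈ f i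
∈-concatF⁻ {suc n} f p with ∈-++⁻ (f fzero) p
... | inj₁ q = fzero , q
... | inj₂ q with ∈-concatF⁻ (f ∘ fsuc) q
...   | i , r = fsuc i , r

when : Bool → A → List A
when b x = if b then x ∷ [] else []

length-when : (b : Bool) (x : A) → length (when b x) ≡ indicator b
length-when true  x = refl
length-when false x = refl

∈-when⁺ : ∀ {b} {x : A} → b ≡ true → x ∈ when b x
∈-when⁺ refl = here refl

∈-when⁻ : ∀ {b} {x y : A} → y ∈ when b x → b ≡ true × y ≡ x
∈-when⁻ {b = true} (here e) = refl , e

-- Reachability

module Reach (R : Fin n → Fin n → Bool) (v : Fin n) where

  all : Fin n → Bool
  all _ = true

  reach : ℕ → Fin n → Bool
  reach k = reachWithin R all k v

  reach-source : ∀ k → reach k v ≡ true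
  reach-source zero    = ⌊⌋-true⁺ (v ≟ v) refl
  reach-source (suc k) rewrite reach-source k = refl

  reach-suc : ∀ k u → reach k u ≡ true → reach (suc k) u ≡ true
  reach-suc k u e rewrite e = refl

  reach-step : ∀ k w u → reach k w ≡ true → R w u ≡ true → reach (suc k) u ≡ true
  reach-step k w u e r
    rewrite anyF⁺ (λ w → reach k w ∧ R w u ∧ true) w (cong₂ _∧_ e (cong (_∧ true) r)) =
    ∨-zeroʳ (reach k u)

  reach-suc⁻ : ∀ k u → reach (suc k) u ≡ true →
               reach k u ≡ true ⊎ ∃[ w ] reach k w ≡ true × R w u ≡ true
  reach-suc⁻ k u e with ∨-true⁻ {reach k u} e
  ... | inj₁ p = inj₁ p
  ... | inj₂ p with anyF⁻ _ p
  ...   | w , q = inj₂ (w , ∧-conicalˡ _ _ q , ∧-conicalˡ _ _ (∧-conicalʳ (reach k w) _ q))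

  Stable : ℕ → Set
  Stable k = ∀ u → reach (suc k) u ≡ true → reach k u ≡ true

  Stable-suc : ∀ k → Stable k → Stable (suc k)
  Stable-suc k s u e with reach-suc⁻ (suc k) u e
  ... | inj₁ p           = p
  ... | inj₂ (w , p , r) = reach-step k w u (s w p) r

  -- Stage 0 holds the source, and every later stage gains a vertex until the process stops; once
  -- stopped it stays stopped.
  stable-or-large : ∀ k → Stable k ⊎ k < count (reach k)
  stable-or-large zero = inj₂ (count-≥1 (reach 0) v (reach-source 0))
  stable-or-large (suc k) with stable-or-large k
  ... | inj₁ s = inj₁ (Stable-suc k s)
  ... | inj₂ l with count-⊆ (reach k) (reach (suc k)) (reach-suc k)
  ...   | inj₁ (s , _) = inj₁ (Stable-suc k s)
  ...   | inj₂ l'      = inj₂ (≤-<-trans l l')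

  stable : Stable n
  stable with stable-or-large n
  ... | inj₁ s = s
  ... | inj₂ l = contradiction l (≤⇒≯ (count≤n (reach n)))

  -- The cutoff at `n` steps thus loses no vertex: a stage that was still growing would hold more
  -- than `n` of them.
  reach-closed : ∀ w u → reach n w ≡ true → R w u ≡ true → reach n u ≡ true
  reach-closed w u e r = stable u (reach-step n w u e r)

  reach-const : (f : Fin n → A) → (∀ x y → R x y ≡ true → f x ≡ f y) →
                ∀ k u → reach k u ≡ true → f v ≡ f u
  reach-const f h zero    u e = cong f (⌊⌋-true⁻ (v ≟ u) e)
  reach-const f h (suc k) u e with reach-suc⁻ k u e
  ... | inj₁ p           = reach-const f h k u p
  ... | inj₂ (w , p , r) = trans (reach-const f h k w p) (h w u r)

module _ (R : Fin n → Fin n → Bool) (R-sym : ∀ x y → R x y ≡ R y x) where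
  open Reach R

  -- Retraces the walk from `v'` to `u` backwards, by symmetry of `R`. Closure of stage `n` keeps
  -- every vertex met on the way within reach of `v`.
  reach-joinable : ∀ v v' u k → reach v n u ≡ true → reach v' k u ≡ true →
                   reach v n v' ≡ true
  reach-joinable v v' u zero    e e' rewrite ⌊⌋-true⁻ (v' ≟ u) e' = e
  reach-joinable v v' u (suc k) e e' with reach-suc⁻ v' k u e'
  ... | inj₁ p           = reach-joinable v v' u k e p
  ... | inj₂ (w , p , r) =
    reach-joinable v v' w k (reach-closed v u w e (trans (R-sym u w) r)) p

-- Links and union-find

Link : ℕ → Set
Link n = Fin n × Fin n

-- Connection through links is expressed by functions constant along each link, so no path in the
-- link graph has to be built.
Respects : (Fin n → A) → List (Link n) → Set
Respects f L = ∀ {p q} → (p , q) ∈ L → f p ≡ f q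

relabel : Fin n → Fin n → Fin n → Fin n
relabel x y z = if ⌊ z ≟ x ⌋ then y else z

relabel-source : (x y : Fin n) → relabel x y x ≡ y
relabel-source x y rewrite ⌊⌋-true⁺ (x ≟ x) refl = refl

relabel-other : (x y : Fin n) {z : Fin n} → z ≢ x → relabel x y z ≡ z
relabel-other x y {z} ne rewrite ⌊⌋-false⁺ (z ≟ x) ne = refl

relabel-target : (x y : Fin n) → relabel x y y ≡ y
relabel-target x y with y ≟ x
... | yes _ = refl
... | no  _ = refl

-- Union-find by renaming: the tail is processed first, then the class of `a` takes the name of the
-- class of `b`. A link inside one class changes nothing.
root : List (Link n) → Fin n → Fin n
root []            z = z
root ((a , b) ∷ L) z = relabel (root L a) (root L b) (root L z)

root-respects : (L : List (Link n)) → Respects (root L) L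
root-respects ((a , b) ∷ L) (here refl) =
  trans (relabel-source (root L a) _) (sym (relabel-target (root L a) _))
root-respects ((a , b) ∷ L) (there p) = cong (relabel _ _) (root-respects L p)

-- Pigeonhole: sending a vertex to its position in `S` is injective.
n≤length : (S : List (Fin n)) → (∀ u → u ∈ S) → n ≤ length S
n≤length S h = injective⇒≤ {f = λ u → index (h u)} λ {u} {w} e →
  trans (lookup-index (h u)) (trans (cong (lookup S) e) (sym (lookup-index (h w))))

-- Each link destroys at most one root.
n≤roots+links : (L : List (Link n)) (S : List (Fin n)) → (∀ u → root L u ∈ S) →
                n ≤ length S + length L
n≤roots+links [] S h = ≤-trans (n≤length S h) (m≤m+n _ 0)
n≤roots+links ((a , b) ∷ L) S h =
  ≤-trans (n≤roots+links L (root L a ∷ S) h') (≤-reflexive (sym (+-suc (length S) (length L))))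
  where
  h' : ∀ u → root L u ∈ root L a ∷ S
  h' u with root L u ≟ root L a
  ... | yes e = here e
  ... | no ne = there (subst (_∈ S) (relabel-other (root L a) (root L b) ne) (h u))

module _ (G : Graph n) where

  -- Counting links against τ

  coAdj-sym : ∀ u v → coAdj G u v ≡ coAdj G v u
  coAdj-sym u v = cong₂ (λ x y → not x ∧ not y) (adj-sym G u v) ≟-sym
    where
    ≟-sym : ⌊ u ≟ v ⌋ ≡ ⌊ v ≟ u ⌋
    ≟-sym with u ≟ v
    ... | yes e = sym (⌊⌋-true⁺ (v ≟ u) (sym e))
    ... | no ne = sym (⌊⌋-false⁺ (v ≟ u) (ne ∘ sym))

  coAdj⇒¬adj : ∀ u v → coAdj G u v ≡ true → adj G u v ≡ false
  coAdj⇒¬adj u v e = not-injective (∧-conicalˡ _ _ e)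

  coComp-refl : ∀ v → coComp G v v ≡ true
  coComp-refl v = Reach.reach-source (coAdj G) v n

  rep-minimal : ∀ v u → isRep G v ≡ true → coComp G v u ≡ true → toℕ v ≤ toℕ u
  rep-minimal v u r c with toℕ u <? toℕ v
  ... | no ¬l = ≮⇒≥ ¬l
  ... | yes l = contradiction
    (trans (sym r) (cong not (anyF⁺ _ u (cong₂ _∧_ c (⌊⌋-true⁺ (toℕ u <? toℕ v) l))))) λ ()

  -- The incidence between representatives and vertices that is counted in two ways in `τ+reps≤n`.
  owns : Fin n → Fin n → Bool
  owns v u = isRep G v ∧ coComp G v u

  -- Two representatives owning `u` lie in one co-connected component, and each has the smallest
  -- index there.
  rep-unique : ∀ u v v' → owns v u ≡ true → owns v' u ≡ true → v ≡ v'
  rep-unique u v v' p p' = toℕ-injective (≤-antisym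
    (rep-minimal v v' (∧-conicalˡ (isRep G v) _ p) (join v v' p p'))
    (rep-minimal v' v (∧-conicalˡ (isRep G v') _ p') (join v' v p' p)))
    where
    join : ∀ v v' → owns v u ≡ true → owns v' u ≡ true →
           coComp G v v' ≡ true
    join v v' p p' = reach-joinable (coAdj G) coAdj-sym v v' u n
      (∧-conicalʳ (isRep G v) _ p) (∧-conicalʳ (isRep G v') _ p')

  -- Descent on the index: a vertex that is not a representative has a smaller one in its component,
  -- where `f` takes the same value. Passing to `f` at each step makes the descent compose by
  -- transitivity of equality.
  rep-exists : (f : Fin n → A) → (∀ u v → coAdj G u v ≡ true → f u ≡ f v) →
               ∀ u → ∃[ r ] isRep G r ≡ true × f u ≡ f r
  rep-exists f h u = go u (<-wellFounded (toℕ u))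
    where
    go : ∀ u → Acc _<_ (toℕ u) → ∃[ r ] isRep G r ≡ true × f u ≡ f r
    go u (acc rs) with anyF (λ w → coComp G u w ∧ ⌊ toℕ w <? toℕ u ⌋) in e
    ... | false = u , cong not e , refl
    ... | true with anyF⁻ _ e
    ...   | w , p with go w (rs (⌊⌋-true⁻ (toℕ w <? toℕ u) (∧-conicalʳ (coComp G u w) _ p)))
    ...     | r , i , q =
      r , i , trans (Reach.reach-const (coAdj G) u f h n w (∧-conicalˡ _ _ p)) q

  -- Both branches of `contrib` are at most |C| - 1, and a singleton contributes 0. Only the empty
  -- set would break strictness.
  contrib<count : (C : Fin n → Bool) → 1 ≤ count C → contrib G C < count C
  contrib<count C l with count C
  ... | suc zero    = ≤-refl
  ... | suc (suc k) with inducedConnected G C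
  ...   | true  = m≤n⇒m≤1+n ≤-refl
  ...   | false = ≤-refl

  -- Each component contributes at most |C| - 1, so adding 1 for its representative stays within
  -- |C|; the components are disjoint.
  τ+reps≤n : τ G + sumF (indicator ∘ isRep G) ≤ n
  τ+reps≤n = begin
    τ G + sumF (indicator ∘ isRep G)
      ≡⟨ sym (sumF-+ _ (indicator ∘ isRep G)) ⟩
    sumF (λ v → (if isRep G v then contrib G (coComp G v) else 0) + indicator (isRep G v))
      ≤⟨ sumF-mono-≤ component ⟩
    sumF (λ v → sumF (λ u → indicator (owns v u)))
      ≡⟨ sumF-swap (λ v u → indicator (owns v u)) ⟩
    sumF (λ u → sumF (λ v → indicator (owns v u)))
      ≤⟨ sumF-mono-≤ owned-once ⟩
    sumF {n} (λ _ → 1)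
      ≡⟨ trans (sumF-const {n} 1) (*-identityʳ n) ⟩
    n ∎
    where
    open ≤-Reasoning
    owned-once : ∀ u → sumF (λ v → indicator (owns v u)) ≤ 1
    owned-once u = ≤-trans (≤-reflexive (sym (count-sumF (λ v → owns v u))))
                     (count-≤1 (λ v → owns v u) (rep-unique u))
    component : ∀ v → (if isRep G v then contrib G (coComp G v) else 0) + indicator (isRep G v)
                      ≤ sumF (λ u → indicator (owns v u))
    component v with isRep G v
    ... | false = z≤n
    ... | true  = begin
      contrib G (coComp G v) + 1 ≡⟨ +-comm _ 1 ⟩
      suc (contrib G (coComp G v))
        ≤⟨ contrib<count (coComp G v) (count-≥1 _ v (coComp-refl v)) ⟩
      count (coComp G v) ≡⟨ count-sumF (coComp G v) ⟩
      sumF (indicator ∘ coComp G v) ∎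

  -- `root L` is constant on each component, so the representatives already realise every root.
  -- Hence `n` is at most components plus links, and cancelling the number of components against
  -- `τ+reps≤n` leaves the claim.
  τ≤links : (L : List (Link n)) →
            (∀ u v → adj G u v ≡ false → root L u ≡ root L v) → τ G ≤ length L
  τ≤links L h = +-cancelʳ-≤ (sumF (indicator ∘ isRep G)) (τ G) (length L) (begin
    τ G + sumF (indicator ∘ isRep G)      ≤⟨ τ+reps≤n ⟩
    n                                     ≤⟨ n≤roots+links L (map (root L) reps) covered ⟩
    length (map (root L) reps) + length L ≡⟨ cong (_+ length L) length-roots ⟩
    sumF (indicator ∘ isRep G) + length L ≡⟨ +-comm _ (length L) ⟩
    length L + sumF (indicator ∘ isRep G) ∎)
    where
    open ≤-Reasoning
    reps : List (Fin n)
    reps = concatF (λ v → when (isRep G v) v)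
    length-roots : length (map (root L) reps) ≡ sumF (indicator ∘ isRep G)
    length-roots = trans (length-map (root L) reps)
      (trans (length-concatF (λ v → when (isRep G v) v)) (sumF-cong (λ v → length-when (isRep G v) v)))
    covered : ∀ u → root L u ∈ map (root L) reps
    covered u with rep-exists (root L) (λ x y e → h x y (coAdj⇒¬adj x y e)) u
    ... | r , i , e = subst (_∈ map (root L) reps) (sym e)
      (∈-map⁺ (root L) (∈-concatF⁺ (λ v → when (isRep G v) v) r (∈-when⁺ i)))

  -- Clusters of edges

  -- The index is the number of merges spent. The two smallest shapes remember adjacencies, because
  -- there the number of vertices alone would cost too many links; `none` fills slots that hold no
  -- edge or have been emptied.
  data Shape : ℕ → List (Fin n) → Set where
    none   : Shape 0 []
    single : ∀ {a b} → adj G a b ≡ true → Shape 0 (a ∷ b ∷ [])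
    cherry : ∀ {a b c} → adj G a b ≡ true → adj G b c ≡ true → Shape 1 (a ∷ b ∷ c ∷ [])
    large  : ∀ {t V} → 2 ≤ t → length V ≤ 2 + t → Shape t V

  record Cluster : Set where
    constructor cluster
    field
      {excess} : ℕ
      {verts}  : List (Fin n)
      shape    : Shape excess verts
  open Cluster

  shape-length : ∀ {t V} → Shape t V → length V ≤ 2 + t
  shape-length none         = z≤n
  shape-length (single _)   = ≤-refl
  shape-length (cherry _ _) = ≤-refl
  shape-length (large _ l)  = l

  without : ∀ {b : Fin n} {V} → b ∈ V →
            ∃[ U ] suc (length U) ≡ length V × (∀ {x} → x ∈ V → x ≡ b ⊎ x ∈ U)
  without {V = _ ∷ V} (here refl) = V , refl , λ where
    (here e)  → inj₁ e
    (there q) → inj₂ q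
  without {V = y ∷ _} (there p) with without p
  ... | U , l , h = y ∷ U , cong suc l , λ where
    (here e)  → inj₂ (here e)
    (there q) → case h q of λ where
      (inj₁ e) → inj₁ e
      (inj₂ r) → inj₂ (there r)

  Merged : ℕ → List (Fin n) → List (Fin n) → Set
  Merged t V V' = ∃[ W ] Shape t W × (∀ {x} → x ∈ V → x ∈ W) × (∀ {x} → x ∈ V' → x ∈ W)

  -- The shared vertex is dropped from one side, so the bounds 2 + t and 2 + t' add up to one less:
  -- exactly 2 plus the new excess. The last hypothesis makes that excess at least 2.
  merge-large : ∀ {t t' V V' b} → Shape t V → Shape t' V' → b ∈ V → b ∈ V' →
                1 ≤ t + t' → Merged (suc (t + t')) V V'
  merge-large {t} {t'} {V} {V'} s s' p p' l with without p'
  ... | U , e , h = V ++ U , large (s≤s l) size , ∈-++⁺ˡ , λ q → case h q of λ where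
      (inj₁ refl) → ∈-++⁺ˡ p
      (inj₂ r)    → ∈-++⁺ʳ V r
    where
    open ≤-Reasoning
    rearrange : ∀ t t' → (2 + t) + (1 + t') ≡ 2 + suc (t + t')
    rearrange = solve-∀
    size : length (V ++ U) ≤ 2 + suc (t + t')
    size = begin
      length (V ++ U)     ≡⟨ length-++ V ⟩
      length V + length U ≤⟨ +-mono-≤ (shape-length s)
                               (s≤s⁻¹ (≤-trans (≤-reflexive e) (shape-length s'))) ⟩
      (2 + t) + (1 + t')  ≡⟨ rearrange t t' ⟩
      2 + suc (t + t')    ∎

  merge-cherry : ∀ {a b c} → adj G a b ≡ true → adj G b c ≡ true →
                 Merged 1 (a ∷ b ∷ []) (b ∷ c ∷ [])
  merge-cherry e e' = _ , cherry e e' ,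
    (λ { (here q) → here q ; (there (here q)) → there (here q) }) , there

  swap : ∀ {a b x : Fin n} → x ∈ a ∷ b ∷ [] → x ∈ b ∷ a ∷ []
  swap (here q)         = there (here q)
  swap (there (here q)) = here q

  adj-flip : ∀ {a b} → adj G a b ≡ true → adj G b a ≡ true
  adj-flip {a} {b} e = trans (adj-sym G b a) e

  -- The new excess is 1 only when two single edges meet. They form a path through the shared
  -- vertex, and the four cases are their orientations; every other pair falls under `merge-large`.
  merge : ∀ {t t' V V' b} → Shape t V → Shape t' V' → b ∈ V → b ∈ V' →
          Merged (suc (t + t')) V V'
  merge (single e) (single e') (here refl) (here refl) with merge-cherry (adj-flip e) e'
  ... | W , s , i , j = W , s , i ∘ swap , j
  merge (single e) (single e') (here refl) (there (here refl))
    with merge-cherry (adj-flip e) (adj-flip e')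
  ... | W , s , i , j = W , s , i ∘ swap , j ∘ swap
  merge (single e) (single e') (there (here refl)) (here refl) = merge-cherry e e'
  merge (single e) (single e') (there (here refl)) (there (here refl))
    with merge-cherry e (adj-flip e')
  ... | W , s , i , j = W , s , i , j ∘ swap
  merge s@(single _) s'@(cherry _ _) p p' = merge-large s s' p p' (s≤s z≤n)
  merge s@(single _) s'@(large l _)  p p' = merge-large s s' p p' (<⇒≤ l)
  merge s@(cherry _ _) s'            p p' = merge-large s s' p p' (s≤s z≤n)
  merge s@(large l _)  s'            p p' = merge-large s s' p p' (m≤n⇒m≤n+o _ (<⇒≤ l))

  -- Links joining one cluster

  -- Quantifying over all `f` lets the links of one cluster be tested against the `root` of the full
  -- list of links, which respects every sublist.
  Joins : List (Link n) → List (Fin n) → Set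
  Joins L V = ∀ (f : Fin n → Fin n) → Respects f L →
              ∀ {x y} → x ∈ V → y ∈ V → adj G x y ≡ false → f x ≡ f y

  cluster-links : ∀ {t V} → Shape t V → ∃[ L ] 2 * length L ≤ 3 * t × Joins L V
  cluster-links none = [] , z≤n , λ _ _ ()
  cluster-links (single {a} {b} e) = [] , z≤n , joins
    where
    joins : Joins [] (a ∷ b ∷ [])
    joins f r (here refl)         (here refl)         _ = refl
    joins f r (here refl)         (there (here refl)) d = contradiction (trans (sym e) d) λ ()
    joins f r (there (here refl)) (here refl)         d = contradiction (trans (sym (adj-flip e)) d) λ ()
    joins f r (there (here refl)) (there (here refl)) _ = refl
  cluster-links (cherry {a} {b} {c} e e') = (a , c) ∷ [] , s≤s (s≤s z≤n) , joins
    where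
    joins : Joins ((a , c) ∷ []) (a ∷ b ∷ c ∷ [])
    joins f r (here refl)                 (here refl)                 _ = refl
    joins f r (here refl)                 (there (here refl))         d = contradiction (trans (sym e) d) λ ()
    joins f r (here refl)                 (there (there (here refl))) _ = r (here refl)
    joins f r (there (here refl))         (here refl)                 d = contradiction (trans (sym (adj-flip e)) d) λ ()
    joins f r (there (here refl))         (there (here refl))         _ = refl
    joins f r (there (here refl))         (there (there (here refl))) d = contradiction (trans (sym e') d) λ ()
    joins f r (there (there (here refl))) (here refl)                 _ = sym (r (here refl))
    joins f r (there (there (here refl))) (there (here refl))         d = contradiction (trans (sym (adj-flip e')) d) λ ()
    joins f r (there (there (here refl))) (there (there (here refl))) _ = refl
  -- The empty list offers no centre for a star.
  cluster-links {V = []} (large _ _) = [] , z≤n , λ _ _ ()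
  cluster-links {t} {v ∷ V} (large l s) = map (v ,_) V , size , joins
    where
    open ≤-Reasoning
    size : 2 * length (map (v ,_) V) ≤ 3 * t
    size = begin
      2 * length (map (v ,_) V) ≡⟨ cong (2 *_) (length-map (v ,_) V) ⟩
      2 * length V              ≤⟨ *-monoʳ-≤ 2 (s≤s⁻¹ s) ⟩
      2 * (1 + t)               ≡⟨ *-suc 2 t ⟩
      -- The only use of t ≥ 2: the estimate 2(t + 1) ≤ 3t fails for t = 0 and t = 1, hence the
      -- separate small shapes.
      2 + 2 * t                 ≤⟨ +-monoˡ-≤ (2 * t) l ⟩
      3 * t                     ∎
    centre : ∀ (f : Fin n → Fin n) → Respects f (map (v ,_) V) → ∀ {x} → x ∈ v ∷ V → f v ≡ f x
    centre f r (here refl) = refl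
    centre f r (there p)   = r (∈-map⁺ (v ,_) p)
    joins : Joins (map (v ,_) V) (v ∷ V)
    joins f r p q _ = trans (sym (centre f r p)) (centre f r q)

  -- Indexing edges, and the initial clusters

  -- An edge is a cell of the n by n table with the smaller endpoint first, so both orientations
  -- share one index and hence one label.
  edge : Fin n → Fin n → Fin (n * n)
  edge a b with toℕ a ≤? toℕ b
  ... | yes _ = combine a b
  ... | no  _ = combine b a

  edge-sym : ∀ a b → edge a b ≡ edge b a
  edge-sym a b with toℕ a ≤? toℕ b | toℕ b ≤? toℕ a
  ... | yes l | yes l' rewrite toℕ-injective (≤-antisym l l') = refl
  ... | yes _ | no _   = refl
  ... | no _  | yes _  = refl
  ... | no l  | no l'  = contradiction (<⇒≤ (≰⇒> l)) l'

  -- The Boolean is an argument with its own equation so that facts about `pairCluster` can be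
  -- proved by matching on a generalised value.
  singleOrNone : ∀ a b x → adj G a b ≡ x → Cluster
  singleOrNone a b true  e = cluster (single e)
  singleOrNone a b false _ = cluster none

  pairCluster : Fin n × Fin n → Cluster
  pairCluster (a , b) = singleOrNone a b (adj G a b) refl

  pairCluster-excess : ∀ p → excess (pairCluster p) ≡ 0
  pairCluster-excess (a , b) = go (adj G a b) refl
    where
    go : ∀ x e → excess (singleOrNone a b x e) ≡ 0
    go true  _ = refl
    go false _ = refl

  pairCluster-verts : ∀ a b → adj G a b ≡ true → verts (pairCluster (a , b)) ≡ a ∷ b ∷ []
  pairCluster-verts a b = go (adj G a b) refl
    where
    go : ∀ x e → x ≡ true → verts (singleOrNone a b x e) ≡ a ∷ b ∷ []
    go true _ _ = refl

  edgeCluster : Fin (n * n) → Cluster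
  edgeCluster k = pairCluster (remQuot n k)

  edgeCluster-combine : ∀ a b → adj G a b ≡ true → verts (edgeCluster (combine a b)) ≡ a ∷ b ∷ []
  edgeCluster-combine a b e =
    trans (cong (verts ∘ pairCluster) (remQuot-combine a b)) (pairCluster-verts a b e)

  edgeCluster-covers : ∀ a b → adj G a b ≡ true → a ∈ verts (edgeCluster (edge a b))
  edgeCluster-covers a b e with toℕ a ≤? toℕ b
  ... | yes _ = subst (a ∈_) (sym (edgeCluster-combine a b e)) (here refl)
  ... | no  _ = subst (a ∈_) (sym (edgeCluster-combine b a (adj-flip e))) (there (here refl))

  -- A balance free of subtraction: the old value is added on one side, the new value on the other.
  sumF-updateAt : ∀ {m} (f : Cluster → ℕ) (c : Fin m → Cluster) (i : Fin m) (d : Cluster) →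
                  sumF (f ∘ updateAt c i (const d)) + f (c i) ≡ sumF (f ∘ c) + f d
  sumF-updateAt f c fzero d = swap-ends (f d) (sumF (f ∘ c ∘ fsuc)) (f (c fzero))
    where
    swap-ends : ∀ x y z → (x + y) + z ≡ (z + y) + x
    swap-ends = solve-∀
  sumF-updateAt f c (fsuc i) d =
    trans (+-assoc (f (c fzero)) _ _)
      (trans (cong (f (c fzero) +_) (sumF-updateAt f (c ∘ fsuc) i d))
        (sym (+-assoc (f (c fzero)) _ _)))

  -- Merging clusters transition by transition

  Triple : Set
  Triple = Fin n × Fin n × Fin n

  Valid : Triple → Set
  Valid (a , b , c) = adj G a b ≡ true × adj G b c ≡ true

  -- The invariant kept while transitions are processed: `label` names the class of an edge and
  -- `clusterOf` is indexed by these names. `covers` speaks of the first endpoint; `edge-sym`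
  -- supplies the other.
  record Clustering (Ts : List Triple) : Set where
    field
      label     : Fin (n * n) → Fin (n * n)
      clusterOf : Fin (n * n) → Cluster
      covers    : ∀ a b → adj G a b ≡ true → a ∈ verts (clusterOf (label (edge a b)))
      joined    : ∀ {a b c} → (a , b , c) ∈ Ts → label (edge a b) ≡ label (edge b c)
      total     : sumF (excess ∘ clusterOf) ≤ length Ts
  open Clustering

  initial : Clustering []
  initial = record
    { label     = λ k → k
    ; clusterOf = edgeCluster
    ; covers    = edgeCluster-covers
    ; joined    = λ ()
    ; total     = ≤-reflexive (trans (sumF-cong (pairCluster-excess ∘ remQuot n))
                                 (trans (sumF-const {n * n} 0) (*-zeroʳ (n * n))))
    }

  -- A transition inside one class adds no excess, which is why `total` is an inequality. Otherwise
  -- the two classes share the middle vertex `b`, and merging them raises the total by exactly one.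
  extend : ∀ {Ts} ((a , b , c) : Triple) → Valid (a , b , c) →
           Clustering Ts → Clustering ((a , b , c) ∷ Ts)
  extend {Ts} (a , b , c) (ab , bc) K
    with label K (edge a b) ≟ label K (edge b c)
  ... | yes e = record
    { label     = label K
    ; clusterOf = clusterOf K
    ; covers    = covers K
    ; joined    = λ { (here refl) → e ; (there p) → joined K p }
    ; total     = m≤n⇒m≤1+n (total K)
    }
  ... | no x≢y = record
    { label     = relabel x y ∘ label K
    ; clusterOf = C'
    ; covers    = λ u w e → covers' (label K (edge u w)) (covers K u w e)
    ; joined    = λ { (here refl) → trans (relabel-source x y) (sym (relabel-target x y))
                    ; (there p)   → cong (relabel x y) (joined K p) }
    ; total     = ≤-trans (≤-reflexive total') (s≤s (total K))
    }
    where
    x y : Fin (n * n)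
    x = label K (edge a b)
    y = label K (edge b c)
    C : Fin (n * n) → Cluster
    C = clusterOf K
    b∈x : b ∈ verts (C x)
    b∈x = subst (λ k → b ∈ verts (C (label K k))) (edge-sym b a) (covers K b a (adj-flip ab))
    merged : Merged (suc (excess (C x) + excess (C y))) (verts (C x)) (verts (C y))
    merged = merge (shape (C x)) (shape (C y)) b∈x (covers K b c bc)
    M : Cluster
    M = cluster (proj₁ (proj₂ merged))
    C₁ C' : Fin (n * n) → Cluster
    -- Class `x` is renamed to `y`. Its slot is emptied so that its excess, now part of `M`, is not
    -- counted twice.
    C₁ = updateAt C x (const (cluster none))
    C' = updateAt C₁ y (const M)
    C'-y : C' y ≡ M
    C'-y = updateAt-updates y C₁
    C'-other : ∀ {k} → k ≢ x → k ≢ y → C' k ≡ C k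
    C'-other {k} k≢x k≢y = trans (updateAt-minimal k y C₁ k≢y) (updateAt-minimal k x C k≢x)
    covers' : ∀ k {u} → u ∈ verts (C k) → u ∈ verts (C' (relabel x y k))
    covers' k p with k ≟ x
    ... | yes refl = subst (λ D → _ ∈ verts D) (sym C'-y) (proj₁ (proj₂ (proj₂ merged)) p)
    ... | no k≢x with k ≟ y
    ...   | yes refl = subst (λ D → _ ∈ verts D) (sym C'-y) (proj₂ (proj₂ (proj₂ merged)) p)
    ...   | no k≢y   = subst (λ D → _ ∈ verts D) (sym (C'-other k≢x k≢y)) p
    total' : sumF (excess ∘ C') ≡ suc (sumF (excess ∘ C))
    -- Adding both old excesses to each side lets the two updates be undone one at a time: first
    -- `y`, then `x`.
    total' = +-cancelʳ-≡ (excess (C x) + excess (C y)) _ _ (begin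
      sumF (excess ∘ C') + (excess (C x) + excess (C y))
        ≡⟨ cong (sumF (excess ∘ C') +_) (+-comm (excess (C x)) _) ⟩
      sumF (excess ∘ C') + (excess (C y) + excess (C x))
        ≡⟨ sym (+-assoc (sumF (excess ∘ C')) _ _) ⟩
      sumF (excess ∘ C') + excess (C y) + excess (C x)
        ≡⟨ cong (λ D → sumF (excess ∘ C') + excess D + excess (C x))
             -- Emptying `x` leaves slot `y` as it was, since the two labels differ.
             (sym (updateAt-minimal y x C (x≢y ∘ sym))) ⟩
      sumF (excess ∘ C') + excess (C₁ y) + excess (C x)
        ≡⟨ cong (_+ excess (C x)) (sumF-updateAt excess C₁ y M) ⟩
      sumF (excess ∘ C₁) + excess M + excess (C x)
        ≡⟨ shuffle (sumF (excess ∘ C₁)) (excess M) (excess (C x)) ⟩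
      sumF (excess ∘ C₁) + excess (C x) + excess M
        ≡⟨ cong (_+ excess M) (sumF-updateAt excess C x (cluster none)) ⟩
      sumF (excess ∘ C) + 0 + suc (excess (C x) + excess (C y))
        ≡⟨ pull (sumF (excess ∘ C)) (excess (C x) + excess (C y)) ⟩
      suc (sumF (excess ∘ C)) + (excess (C x) + excess (C y)) ∎)
      where
      open ≡-Reasoning
      shuffle : ∀ p q r → p + q + r ≡ p + r + q
      shuffle = solve-∀
      pull : ∀ p q → p + 0 + suc q ≡ suc p + q
      pull = solve-∀

  clustering : (Ts : List Triple) → (∀ {t} → t ∈ Ts → Valid t) → Clustering Ts
  clustering []       v = initial
  clustering (t ∷ Ts) v = extend t (v (here refl)) (clustering Ts (v ∘ there))

  -- The links of a whole clustering

  module _ {Ts : List Triple} (K : Clustering Ts) where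

    clusterLinks : Fin (n * n) → List (Link n)
    clusterLinks k = proj₁ (cluster-links (shape (clusterOf K k)))

    links : List (Link n)
    links = concatF clusterLinks

    links-length : 2 * length links ≤ 3 * length Ts
    links-length = begin
      2 * length links                         ≡⟨ cong (2 *_) (length-concatF clusterLinks) ⟩
      2 * sumF (length ∘ clusterLinks)         ≡⟨ sym (sumF-* 2 (length ∘ clusterLinks)) ⟩
      sumF (λ k → 2 * length (clusterLinks k))
        ≤⟨ sumF-mono-≤ (λ k → proj₁ (proj₂ (cluster-links (shape (clusterOf K k))))) ⟩
      sumF (λ k → 3 * excess (clusterOf K k))  ≡⟨ sumF-* 3 (excess ∘ clusterOf K) ⟩
      3 * sumF (excess ∘ clusterOf K)          ≤⟨ *-monoʳ-≤ 3 (total K) ⟩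
      3 * length Ts                            ∎
      where open ≤-Reasoning

    links-join : ∀ k {u v} → u ∈ verts (clusterOf K k) → v ∈ verts (clusterOf K k) →
                 adj G u v ≡ false → root links u ≡ root links v
    links-join k = proj₂ (proj₂ (cluster-links (shape (clusterOf K k)))) (root links)
      λ p → root-respects links (∈-concatF⁺ clusterLinks k p)

  -- Compatible walks stay in one cluster

  module _ (T : TransitionSet G) where

    listed : Fin n → Fin n → Fin n → Bool
    listed a b c = mem T a b c ∧ ⌊ toℕ a <? toℕ c ⌋

    row : Fin n → Fin n → List Triple
    row a b = concatF λ c → when (listed a b c) (a , b , c)

    -- The nesting follows the triple sum in `card`, so the lengths agree term by term and each
    -- transition is listed in one orientation only.
    transitions : List Triple
    transitions = concatF λ a → concatF (row a)

    length-transitions : length transitions ≡ card T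
    length-transitions =
      trans (length-concatF λ a → concatF (row a)) (sumF-cong λ a →
      trans (length-concatF (row a)) (sumF-cong λ b →
      trans (length-concatF λ c → when (listed a b c) (a , b , c))
        (trans (sumF-cong λ c → length-when (listed a b c) (a , b , c))
          (sym (count-sumF (listed a b))))))

    transitions-valid : ∀ {t} → t ∈ transitions → Valid t
    transitions-valid p with ∈-concatF⁻ (λ a → concatF (row a)) p
    ... | a , q with ∈-concatF⁻ (row a) q
    ...   | b , r with ∈-concatF⁻ (λ c → when (listed a b c) (a , b , c)) r
    ...     | c , s with ∈-when⁻ {b = listed a b c} s
    ...       | e , refl with mem-valid T a b c (∧-conicalˡ _ _ e)
    ...         | ab , bc , _ = ab , bc

    mem⇒∈transitions : ∀ {a b c} → mem T a b c ≡ true → toℕ a < toℕ c → (a , b , c) ∈ transitions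
    mem⇒∈transitions {a} {b} {c} m l =
      ∈-concatF⁺ (λ a → concatF (row a)) a (∈-concatF⁺ (row a) b
        (∈-concatF⁺ (λ c → when (listed a b c) (a , b , c)) c
          (∈-when⁺ (cong₂ _∧_ m (⌊⌋-true⁺ (toℕ a <? toℕ c) l)))))

    K : Clustering transitions
    K = clustering transitions transitions-valid

    -- Backtracking repeats the same unordered edge. A genuine transition is listed either as abc or
    -- as cba, and `edge-sym` turns the second case into the first.
    label-step : ∀ a b c → mem T a b c ≡ true ⊎ a ≡ c → label K (edge a b) ≡ label K (edge b c)
    label-step a b c (inj₂ refl) = cong (label K) (edge-sym a b)
    label-step a b c (inj₁ m) with <-cmp (toℕ a) (toℕ c)
    ... | tri< l _ _ = joined K (mem⇒∈transitions m l)
    ... | tri≈ _ e _ = contradiction (toℕ-injective e) (proj₂ (proj₂ (mem-valid T a b c m)))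
    ... | tri> _ _ l =
      trans (cong (label K) (edge-sym a b))
        (trans (sym (joined K (mem⇒∈transitions (trans (mem-sym T c b a) m) l)))
          (cong (label K) (edge-sym c b)))

    -- By `label-step` all edges of the walk carry the label of its first edge, and the cluster of
    -- the last edge contains its endpoint.
    walk-in-cluster : ∀ u x xs → IsWalk G u (x ∷ xs) → Compatible T u (x ∷ xs) →
                      lastFrom x xs ∈ verts (clusterOf K (label K (edge u x)))
    walk-in-cluster u x [] (ux , _) _ =
      subst (λ k → x ∈ verts (clusterOf K (label K k))) (edge-sym x u) (covers K x u (adj-flip ux))
    walk-in-cluster u x (y ∷ ys) (_ , w) (s , c) =
      subst (λ k → lastFrom y ys ∈ verts (clusterOf K k)) (sym (label-step u x y s))
        (walk-in-cluster x y ys w c)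

    connecting⇒linked : IsConnectingTransitionSet T →
                        ∀ u v → adj G u v ≡ false → root (links K) u ≡ root (links K) v
    connecting⇒linked conn u v d with conn u v
    ... | []     , _           , _ , refl = refl
    ... | x ∷ xs , w@(ux , _) , c , refl =
      -- Both ends of the walk lie in the cluster of its first edge, whose links join them as they
      -- are non-adjacent.
      links-join K (label K (edge u x)) (covers K u x ux) (walk-in-cluster u x xs w c) d

    connecting-bound : IsConnectingTransitionSet T → 2 * τ G ≤ 3 * card T
    connecting-bound conn = begin
      2 * τ G                ≤⟨ *-monoʳ-≤ 2 (τ≤links (links K) (connecting⇒linked conn)) ⟩
      2 * length (links K)   ≤⟨ links-length K ⟩
      3 * length transitions ≡⟨ cong (3 *_) length-transitions ⟩
      3 * card T             ∎
      where open ≤-Reasoning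

theorem7 : (n : ℕ) → 2 ≤ n → (G : Graph n) → Connected G →
    (T : TransitionSet G) → IsMinimumConnectingTransitionSet T →
    2 * τ G ≤ 3 * card T
theorem7 n _ G _ T (conn , _) = connecting-bound G T conn
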